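{- Let $t$ be a positive integer. Every $t$-coloring of the edges of the ordered complete graph on $[t+3]$ contains a monochromatic non-nested matching of size $2$; that is, there exist two independent edges of the same color that are not nested.
   Context: The ordered complete graph on $[m]=\{1,\dots,m\}$ is the complete graph with vertex set $[m]$, taken with its natural ordering; edges are written $(i,j)$ with $i<j$. A $t$-coloring assigns one of $t$ colors to each edge. Two edges are independent if they share no vertex; independent edges $(a,b)$ and $(c,d)$ are nested if $a<c<d<b$ or $c<a<b<d$. A matching is a set of pairwise independent edges; it is non-nested if no two of its edges are nested, and monochromatic if all its edges have the same color. -}

module Defs where

open import Data.Nat using (ℕ)
open import Data.Fin using (Fin; _<_)
open import Data.List using (List)
open import Data.List.Relation.Unary.All using (All)
open import Data.List.Relation.Unary.AllPairs using (AllPairs)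
open import Data.Product using (_×_; ∃-syntax)
open import Data.Sum using (_⊎_)
open import Relation.Binary.PropositionalEquality using (_≡_; _≢_)
open import Relation.Nullary using (¬_)

-- Edges of the ordered complete graph on Fin m, which stands for {1,…,m} with
-- its natural order. The proof of lo < hi is irrelevant, so an edge is
-- determined by its endpoints and a coloring depends on the endpoints alone.
record Edge (m : ℕ) : Set where
  constructor edge
  field
    lo     : Fin m
    hi     : Fin m
    .lo<hi : lo < hi

open Edge public using (lo; hi)

Coloring : ℕ → ℕ → Set
Coloring t m = Edge m → Fin t

Independent : ∀ {m} → Edge m → Edge m → Set
Independent e f = lo e ≢ lo f × lo e ≢ hi f × hi e ≢ lo f × hi e ≢ hi f

-- The middle inequality of a < c < d < b is part of the data of the inner edge.
-- Nested edges are automatically independent.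
Nested : ∀ {m} → Edge m → Edge m → Set
Nested e f = (lo e < lo f × hi f < hi e) ⊎ (lo f < lo e × hi e < hi f)

-- Independence is irreflexive, so the edges listed in a matching are distinct
-- and the length of the list is the size of the matching.
IsMatching : ∀ {m} → List (Edge m) → Set
IsMatching = AllPairs Independent

NonNested : ∀ {m} → List (Edge m) → Set
NonNested = AllPairs (λ e f → ¬ Nested e f)

Monochromatic : ∀ {t m} → Coloring t m → List (Edge m) → Set
Monochromatic c M = ∃[ k ] All (λ e → c e ≡ k) M

{-# OPTIONS --safe #-}

-- Only the edges (a , b) with a + 2 ≤ b matter: by induction on t they cannot be
-- coloured properly with t colours on 3 + t vertices, where proper means that
-- independent non-nested edges get different colours. Number the vertices from
-- 0 and let T be the colour of (0 , 2). Every edge of colour T has the form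
-- (0 , x) or (2 , y), and x ≥ y whenever x > 2. So some threshold separates the
-- y's from the x's, and with it the edges of the graph with one vertex fewer map
-- to edges avoiding T: vertices 0 and 1 play the first vertex, vertices 1 and 2
-- the second one, the choice depending on whether the right endpoint lies before
-- or after the threshold, and every other vertex is shifted by one.
module Submission where

open import Defs
open import Data.Nat using (ℕ; zero; suc; _+_; _≤_; _<_; _≟_; _<?_; _≤?_; z≤n; s≤s; s<s; z<s; NonZero)
open import Data.Nat.Properties
open import Data.Empty using (⊥-elim)
open import Data.Fin using (toℕ; fromℕ<)
open import Data.Fin.Properties using (toℕ<n; toℕ-fromℕ<; toℕ-injective; fromℕ<-injective)
open import Data.List using (length; []; _∷_)
open import Data.List.Relation.Unary.All using ([]; _∷_)
open import Data.List.Relation.Unary.AllPairs using ([]; _∷_)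
open import Data.Product using (_×_; _,_; ∃-syntax)
open import Data.Sum using (inj₁; inj₂)
open import Function using (_∘_; case_of_)
open import Relation.Binary.PropositionalEquality using (_≡_; _≢_; refl; sym; trans; subst; subst₂)
open import Relation.Nullary using (¬_; Dec; yes; no; contradiction; _×-dec_; ¬?)
open import Relation.Unary using (Pred; Decidable)

least : ∀ {p} {P : Pred ℕ p} → Decidable P → ∀ n →
  ∃[ m ] (∀ {x} → x < m → ¬ P x) × (m < n → P m)
least P? zero = 0 , (λ ()) , λ ()
least P? (suc n) with P? 0
... | yes p0 = 0 , (λ ()) , λ _ → p0
... | no ¬p0 with least (P? ∘ suc) n
...   | m , below , at =
        suc m , (λ { {zero} _ → ¬p0 ; {suc x} (s<s x<m) → below x<m }) , λ { (s<s m<n) → at m<n }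

-- Listing the edge with the smaller left end first turns non-nesting into `b < d`, and independence
-- then only asks for `b ≢ c`.
Conflict : (ℕ → ℕ → ℕ) → ℕ → ℕ → ℕ → ℕ → Set
Conflict χ a b c d = 2 + a ≤ b × 2 + c ≤ d × a < c × b < d × b ≢ c × χ a b ≡ χ c d

Proper : (ℕ → ℕ → ℕ) → ℕ → Set
Proper χ n = ∀ {a b c d} → d < n → ¬ Conflict χ a b c d

Bounded : (ℕ → ℕ → ℕ) → ℕ → ℕ → Set
Bounded χ n t = ∀ {a b} → 2 + a ≤ b → b < n → χ a b < t

-- Frees the colour t by letting T, which must not occur, take its place.
recolour : ℕ → ℕ → ℕ → ℕ
recolour t T x with x ≟ t
... | yes _ = T
... | no  _ = x

recolour-< : ∀ {t T x} → T < suc t → x < suc t → x ≢ T → recolour t T x < t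
recolour-< {t} {T} {x} (s≤s T≤t) (s≤s x≤t) x≢T with x ≟ t
... | yes refl = ≤∧≢⇒< T≤t (x≢T ∘ sym)
... | no  x≢t  = ≤∧≢⇒< x≤t x≢t

recolour-injective : ∀ {t T x y} → x ≢ T → y ≢ T → recolour t T x ≡ recolour t T y → x ≡ y
recolour-injective {t} {T} {x} {y} x≢T y≢T eq with x ≟ t | y ≟ t
... | yes x≡t | yes y≡t = trans x≡t (sym y≡t)
... | yes _   | no  _   = contradiction (sym eq) y≢T
... | no  _   | yes _   = contradiction eq x≢T
... | no  _   | no  _   = eq

-- The edge (a , b) of the smaller graph is mapped to (left m a b , suc b).
left : ℕ → ℕ → ℕ → ℕ
left m 0 b with b <? m
... | yes _ = 0
... | no  _ = 1
left m 1 b with b ≤? m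
... | yes _ = 1
... | no  _ = 2
left m a@(suc (suc _)) b = suc a

left-≤ : ∀ m a b → left m a b ≤ suc a
left-≤ m 0 b with b <? m
... | yes _ = z≤n
... | no  _ = ≤-refl
left-≤ m 1 b with b ≤? m
... | yes _ = s≤s z≤n
... | no  _ = ≤-refl
left-≤ m (suc (suc a)) b = ≤-refl

-- The delicate case is `a = 0`, `c = 1`: at right end `m` both vertices go to `1`, but once `b` has
-- reached `m`, the larger `d` has passed it.
left-mono-< : ∀ m {a b c d} → a < c → b < d → left m a b < left m c d
left-mono-< m {0} {b} {1} {d} _ b<d with b <? m | d ≤? m
... | yes _   | yes _   = z<s
... | yes _   | no  _   = z<s
... | no  b≮m | yes d≤m = contradiction (<-≤-trans b<d d≤m) b≮m
... | no  _   | no  _   = ≤-refl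
left-mono-< m {a} {b} {suc (suc c)} a<c _ = s≤s (≤-trans (left-≤ m a b) a<c)
left-mono-< m {suc a} {c = 1} (s≤s ()) _

-- Here the restriction to edges of length at least two pays off: `2 ≤ b` puts `suc b` beyond every
-- image of `0` and `1`.
left-≢ : ∀ m {b c} d → 2 ≤ b → b ≢ c → suc b ≢ left m c d
left-≢ m {c = 0} d 2≤b _ = >⇒≢ (≤-<-trans (left-≤ m 0 d) (m≤n⇒m≤1+n 2≤b))
left-≢ m {c = 1} d 2≤b _ = >⇒≢ (≤-<-trans (left-≤ m 1 d) (s≤s 2≤b))
left-≢ m {c = suc (suc c)} d _ b≢c = b≢c ∘ suc-injective

no-proper-colouring : ∀ t χ → Proper χ (3 + t) → ¬ Bounded χ (3 + t) t
no-proper-colouring zero χ _ bounded = contradiction (bounded {0} {2} ≤-refl ≤-refl) λ ()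
no-proper-colouring (suc t) χ proper bounded =
  -- If no `b < 3 + t` satisfies `First`, then `m = 3 + t` lies past all right ends of the smaller
  -- graph.
  let m , below , at = least first? (3 + t) in step m below at
  where
  T : ℕ
  T = χ 0 2

  First : ℕ → Set
  First b = 2 ≤ b × χ 0 (suc b) ≡ T

  first? : Decidable First
  first? b = (2 ≤? b) ×-dec (χ 0 (suc b) ≟ T)

  step : ∀ m → (∀ {x} → x < m → ¬ First x) → ¬ (m < 3 + t → First m)
  step m below at = no-proper-colouring t χ′ proper′ bounded′
    where
    χ′ : ℕ → ℕ → ℕ
    χ′ a b = recolour t T (χ (left m a b) (suc b))

    -- The edge `(0 , 2)` has colour `T`, starts and ends further left, and shares no vertex with
    -- `(a , suc b)`.
    crosses-02 : ∀ {a b} → 0 < a → a ≢ 2 → 1 + a ≤ b → b < 3 + t → χ a (suc b) ≢ T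
    crosses-02 0<a a≢2 a<b b<n eq =
      proper (s≤s b<n) (≤-refl , s≤s a<b , 0<a , s≤s (≤-trans (s≤s 0<a) a<b) , a≢2 ∘ sym , sym eq)

    avoids-T : ∀ a {b} → 2 + a ≤ b → b < 3 + t → χ (left m a b) (suc b) ≢ T
    avoids-T 0 {b} 2≤b b<n with b <? m
    ... | yes b<m = λ eq → below b<m (2≤b , eq)
    ... | no  _   = crosses-02 z<s (λ ()) 2≤b b<n
    avoids-T 1 {b} 3≤b b<n with b ≤? m
    ... | yes _   = crosses-02 z<s (λ ()) (<⇒≤ 3≤b) b<n
    -- The conflict is with `(0 , suc m)`. At `b = m` the two edges would share their right end, so
    -- vertex `1` switches to `2` only beyond `m`.
    ... | no  b≰m = λ eq →
      let m<b = ≰⇒> b≰m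
          2≤m , first = at (<-trans m<b b<n)
      in proper (s≤s b<n)
           (m≤n⇒m≤1+n 2≤m , s≤s 3≤b , z<s , s≤s m<b , >⇒≢ (s≤s 2≤m) , trans first (sym eq))
    avoids-T (suc (suc a)) 4+a≤b b<n = crosses-02 z<s (λ ()) 4+a≤b b<n

    proper′ : Proper χ′ (3 + t)
    proper′ {a} {b} {c} {d} d<n (2+a≤b , 2+c≤d , a<c , b<d , b≢c , eq) = proper (s≤s d<n)
      ( s≤s (≤-trans (s≤s (left-≤ m a b)) 2+a≤b)
      , s≤s (≤-trans (s≤s (left-≤ m c d)) 2+c≤d)
      , left-mono-< m a<c b<d
      , s≤s b<d
      , left-≢ m d (m+n≤o⇒m≤o 2 2+a≤b) b≢c
      , recolour-injective (avoids-T a 2+a≤b (<-trans b<d d<n)) (avoids-T c 2+c≤d d<n) eq )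

    bounded′ : Bounded χ′ (3 + t) t
    bounded′ {a} {b} 2+a≤b b<n = recolour-<
      (bounded {0} {2} ≤-refl (s≤s (s≤s (s≤s z≤n))))
      (bounded (s≤s (≤-trans (s≤s (left-≤ m a b)) 2+a≤b)) (s≤s b<n))
      (avoids-T a 2+a≤b b<n)

module _ {t n : ℕ} (c : Coloring t n) where

  edgeAt : ∀ {a b} → a < b → b < n → Edge n
  edgeAt {a} {b} a<b b<n = edge (fromℕ< (<-trans a<b b<n)) (fromℕ< b<n)
    (subst₂ _<_ (sym (toℕ-fromℕ< (<-trans a<b b<n))) (sym (toℕ-fromℕ< b<n)) a<b)

  colour : ℕ → ℕ → ℕ
  colour a b with a <? b | b <? n
  ... | yes a<b | yes b<n = toℕ (c (edgeAt a<b b<n))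
  -- An arbitrary value: `Proper` and `Bounded` only look at genuine edges.
  ... | _       | _       = 0

  colour-edgeAt : ∀ {a b} (a<b : a < b) (b<n : b < n) → colour a b ≡ toℕ (c (edgeAt a<b b<n))
  colour-edgeAt {a} {b} a<b b<n with a <? b | b <? n
  ... | yes _   | yes _   = refl
  ... | no  a≮b | _       = contradiction a<b a≮b
  ... | yes _   | no  b≮n = contradiction b<n b≮n

  colour-bounded : Bounded colour n t
  colour-bounded 2+a≤b b<n =
    subst (_< t) (sym (colour-edgeAt (<⇒≤ 2+a≤b) b<n)) (toℕ<n _)

  BadPair : Set
  BadPair = ∃[ d ] d < n × ∃[ b ] b < d × ∃[ e ] e < d × ∃[ a ] a < e × Conflict colour a b e d

  -- All vertices of a conflict lie below `n`, so a finite search decides its existence; this lets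
  -- the impossibility of a proper colouring yield an actual pair constructively.
  badPair? : Dec BadPair
  badPair? = anyUpTo? (λ d → anyUpTo? (λ b → anyUpTo? (λ e → anyUpTo? (λ a →
    (2 + a ≤? b) ×-dec (2 + e ≤? d) ×-dec (a <? e) ×-dec (b <? d) ×-dec ¬? (b ≟ e)
      ×-dec (colour a b ≟ colour e d)) e) d) d) n

  ¬badPair⇒proper : ¬ BadPair → Proper colour n
  ¬badPair⇒proper ¬bad d<n conflict@(_ , 2+e≤d , a<e , b<d , _) =
    ¬bad (_ , d<n , _ , b<d , _ , <⇒≤ 2+e≤d , _ , a<e , conflict)

  badPair⇒matching : BadPair → ∃[ M ] IsMatching M × NonNested M × Monochromatic c M × length M ≡ 2
  badPair⇒matching (d , d<n , b , b<d , e , e<d , a , a<e , 2+a≤b , _ , _ , _ , b≢e , eq) =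
    f ∷ g ∷ []
    , (( (λ p → <⇒≢ a<e (vertices p))
       , (λ p → <⇒≢ (<-trans a<e e<d) (vertices p))
       , (λ p → b≢e (vertices p))
       , (λ p → <⇒≢ b<d (vertices p)) ) ∷ []) ∷ [] ∷ []
    , ((λ { (inj₁ (_ , d<b)) → <-asym b<d (positions d<n b<n d<b)
          ; (inj₂ (e<a , _)) → <-asym a<e (positions (<-trans e<d d<n) (<-trans a<b b<n) e<a) }) ∷ []) ∷ [] ∷ []
    , (c g , toℕ-injective (trans (sym (colour-edgeAt a<b b<n)) (trans eq (colour-edgeAt e<d d<n))) ∷ refl ∷ [])
    , refl
    where
    a<b = <⇒≤ 2+a≤b
    b<n = <-trans b<d d<n
    f = edgeAt a<b b<n
    g = edgeAt e<d d<n

    vertices : ∀ {x y} .{x<n : x < n} .{y<n : y < n} → fromℕ< x<n ≡ fromℕ< y<n → x ≡ y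
    vertices {x<n = x<n} {y<n} = fromℕ<-injective _ _ x<n y<n

    positions : ∀ {x y} (x<n : x < n) (y<n : y < n) → toℕ (fromℕ< x<n) < toℕ (fromℕ< y<n) → x < y
    positions x<n y<n = subst₂ _<_ (toℕ-fromℕ< x<n) (toℕ-fromℕ< y<n)

theorem2p11 : ∀ (t : ℕ) .{{_ : NonZero t}} (c : Coloring t (t + 3)) →
    ∃[ M ] IsMatching M × NonNested M × Monochromatic c M × length M ≡ 2
theorem2p11 t rewrite +-comm t 3 = λ c → case badPair? c of λ where
  (yes bad) → badPair⇒matching c bad
  (no ¬bad) → ⊥-elim (no-proper-colouring t (colour c) (¬badPair⇒proper c ¬bad) (colour-bounded c))
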